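{- Let $\vdash s:A$ be a valid typing judgment (with empty typing context) of the computational algebraic lambda-calculus over a ring $\mathcal{A}$. Then there exists an index $n_s$ such that any rewrite sequence $(s_i)_i$ for the reduction $\to$ with $s_0=s$ is finite and has at most $n_s$ elements.
   Context: $\mathcal{A}$ is a ring; its elements are called scalars. **Types.** $A,B ::= \iota \mid A\to B\mid A\times B\mid \top\mid MA$, where $\iota$ ranges over a set of type constants. **Terms** of the computational algebraic lambda-calculus are taken up to $\alpha$-equivalence. Computations are $$s,t ::= x\mid\lambda x.s\mid st\mid\langle s,t\rangle\mid\pi_1(s)\mid\pi_2(s)\mid\ast\mid s+t\mid\alpha\cdot s\mid\mathbf{0}\mid[s]\mid\{s\}\qquad(\alpha\in\mathcal{A}),$$ and values are the terms of the form $$u,v ::= x\mid\lambda x.u\mid uv\mid\langle u,v\rangle\mid\pi_1(u)\mid\pi_2(u)\mid\ast\mid[s]$$ with $s$ an arbitrary computation. **Typing rules** ($\Delta$ is a typing context, i.e. a finite assignment of types to variables): $\Delta,x:A\vdash x:A$; $\Delta\vdash\ast:\top$; $\Delta\vdash\mathbf{0}:A$ for every type $A$; if $\Delta,x:A\vdash s:B$ then $\Delta\vdash\lambda x.s:A\to B$; if $\Delta\vdash s:A\to B$ and $\Delta\vdash t:A$ then $\Delta\vdash st:B$; if $\Delta\vdash s:A\times B$ then $\Delta\vdash\pi_1(s):A$ and $\Delta\vdash\pi_2(s):B$; if $\Delta\vdash s:A$ and $\Delta\vdash t:B$ then $\Delta\vdash\langle s,t\rangle:A\times B$; if $\Delta\vdash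 s:A$ then $\Delta\vdash\alpha\cdot s:A$; if $\Delta\vdash s:MA$ then $\Delta\vdash\{s\}:A$; if $\Delta\vdash s:A$ then $\Delta\vdash[s]:MA$; if $\Delta\vdash s:A$ and $\Delta\vdash t:A$ then $\Delta\vdash s+t:A$. **Congruence.** A relation $R$ on terms is call-by-value congruent if, whenever $(s,s')\in R$ and $t$ is a term, the relation $R$ also contains $(st,s't)$, $(ts,ts')$, $(s+t,s'+t)$, $(t+s,t+s')$, $(\langle s,t\rangle,\langle s',t\rangle)$, $(\langle t,s\rangle,\langle t,s'\rangle)$, $(\pi_1(s),\pi_1(s'))$, $(\pi_2(s),\pi_2(s'))$, $(\alpha\cdot s,\alpha\cdot s')$ and $(\{s\},\{s'\})$. It is congruent if moreover it contains $(\lambda x.s,\lambda x.s')$ and $([s],[s'])$ whenever it contains $(s,s')$. The relation $\simeq_{AC}$ is the smallest congruent equivalence relation with $s+t\simeq_{AC}t+s$ and $r+(s+t)\simeq_{AC}(r+s)+t$. A relation $R$ is consistent with $\simeq_{AC}$ if $s\simeq_{AC}s'\,R\,t'\simeq_{AC}t$ implies $s\,R\,t$. **Reduction.** $E,F,A,B$ are the smallest call-by-value congruent relations consistent with $\simeq_{AC}$ that contain the following rules, where $r,s,t$ are terms, $u,v$ are values and $\alpha,\beta\in\mathcal{A}$. $E$: $\alpha\cdot\mathbf{0}\to\mathbf{0}$; $\mathbf{0}+s\to s$; $\alpha\cdot(\beta\cdot s)\to(\alpha\beta)\cdot s$; $0\cdot s\to\mathbf{0}$; $1\cdot s\to s$;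 $\alpha\cdot(s+t)\to\alpha\cdot s+\alpha\cdot t$. $F$: $\alpha\cdot s+\beta\cdot s\to(\alpha+\beta)\cdot s$; $\alpha\cdot s+s\to(\alpha+1)\cdot s$; $s+s\to(1+1)\cdot s$. $A$: $(s+t)r\to sr+tr$; $(\alpha\cdot s)r\to\alpha\cdot(sr)$; $\mathbf{0}r\to\mathbf{0}$; $r(s+t)\to rs+rt$; $r(\alpha\cdot s)\to\alpha\cdot(rs)$; $r\mathbf{0}\to\mathbf{0}$; $\lambda x.(s+t)\to\lambda x.s+\lambda x.t$; $\lambda x.(\alpha\cdot s)\to\alpha\cdot\lambda x.s$; $\lambda x.\mathbf{0}\to\mathbf{0}$; $\{s+t\}\to\{s\}+\{t\}$; $\{\alpha\cdot s\}\to\alpha\cdot\{s\}$; $\{\mathbf{0}\}\to\mathbf{0}$. $B$: $(\lambda x.s)v\to s[x\leftarrow v]$; $\{[s]\}\to s$; $\pi_1\langle u,v\rangle\to u$; $\pi_2\langle u,v\rangle\to v$. The reduction $\to$ is the union $A\cup B\cup E\cup F$. A term $s$ is normal if there is no $t$ with $s\to t$. A rewrite sequence is a (finite or infinite) sequence $(s_i)_i$ of terms such that for every $i$, either $s_i\to s_{i+1}$, or $s_i$ is normal and $i$ is the last index of the sequence. -}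

module Defs where

open import Algebra.Bundles using (Ring)
open import Data.Fin.Base using (Fin; zero; suc)
open import Data.Maybe.Base using (Maybe; just; nothing)
open import Data.Nat.Base using (ℕ; zero; suc; _≤_; _<_)
open import Data.Product.Base using (_×_; ∃-syntax)
open import Data.Sum.Base using (_⊎_)
open import Data.Vec.Base using (Vec; _∷_; lookup)
open import Function.Bundles using (_⇔_)
open import Level using (Level; _⊔_)
open import Relation.Binary.Construct.Union using (_∪_)
open import Relation.Binary.Core using (Rel)
open import Relation.Binary.PropositionalEquality.Core using (_≡_)
open import Relation.Nullary.Negation.Core using (¬_)

module Calculus {c ℓ k : Level} (𝒜 : Ring c ℓ) (TyConst : Set k) where

  open Ring 𝒜 using (_≈_; _+_; _*_; 0#; 1#) renaming (Carrier to Scalar)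

  infixr 7 _⇒_
  infixr 8 _⊗_

  data Type : Set k where
    ι    : TyConst → Type
    _⇒_  : Type → Type → Type
    _⊗_  : Type → Type → Type
    unit : Type
    M    : Type → Type

  infixl 9 _∙_
  infixr 8 _⊙_
  infixl 6 _⊞_
  infix  5 ƛ_

  -- Terms up to α-equivalence, as well-scoped de Bruijn terms: Term n has its
  -- free variables among n.  The computation written {s} on paper is ❴ s ❵.
  data Term (n : ℕ) : Set c where
    var   : Fin n → Term n
    ƛ_    : Term (suc n) → Term n
    _∙_   : Term n → Term n → Term n
    ⟨_,_⟩ : Term n → Term n → Term n
    π₁    : Term n → Term n
    π₂    : Term n → Term n
    ∗     : Term n
    _⊞_   : Term n → Term n → Term n
    _⊙_   : Scalar → Term n → Term n
    𝟎     : Term n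
    [_]   : Term n → Term n
    ❴_❵   : Term n → Term n

  private variable
    m n : ℕ
    r s s′ t t′ u v : Term n
    α β : Scalar
    A B : Type
    Δ : Vec Type n

  data Value {n : ℕ} : Term n → Set c where
    var   : (x : Fin n) → Value (var x)
    ƛ_    : Value u → Value (ƛ u)
    _∙_   : Value u → Value v → Value (u ∙ v)
    ⟨_,_⟩ : Value u → Value v → Value ⟨ u , v ⟩
    π₁    : Value u → Value (π₁ u)
    π₂    : Value u → Value (π₂ u)
    ∗     : Value ∗
    [_]   : (s : Term n) → Value [ s ]

  infix 4 _⊢_∶_

  data _⊢_∶_ {n : ℕ} (Δ : Vec Type n) : Term n → Type → Set (c ⊔ k) where
    var  : (x : Fin n) → Δ ⊢ var x ∶ lookup Δ x
    ∗    : Δ ⊢ ∗ ∶ unit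
    𝟎    : Δ ⊢ 𝟎 ∶ A
    lam  : A ∷ Δ ⊢ s ∶ B → Δ ⊢ ƛ s ∶ A ⇒ B
    app  : Δ ⊢ s ∶ A ⇒ B → Δ ⊢ t ∶ A → Δ ⊢ s ∙ t ∶ B
    fst  : Δ ⊢ s ∶ A ⊗ B → Δ ⊢ π₁ s ∶ A
    snd  : Δ ⊢ s ∶ A ⊗ B → Δ ⊢ π₂ s ∶ B
    pair : Δ ⊢ s ∶ A → Δ ⊢ t ∶ B → Δ ⊢ ⟨ s , t ⟩ ∶ A ⊗ B
    scal : Δ ⊢ s ∶ A → Δ ⊢ α ⊙ s ∶ A
    run  : Δ ⊢ s ∶ M A → Δ ⊢ ❴ s ❵ ∶ A
    box  : Δ ⊢ s ∶ A → Δ ⊢ [ s ] ∶ M A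
    sum  : Δ ⊢ s ∶ A → Δ ⊢ t ∶ A → Δ ⊢ s ⊞ t ∶ A

  liftRen : (Fin m → Fin n) → Fin (suc m) → Fin (suc n)
  liftRen ρ zero    = zero
  liftRen ρ (suc x) = suc (ρ x)

  rename : (Fin m → Fin n) → Term m → Term n
  rename ρ (var x)   = var (ρ x)
  rename ρ (ƛ s)     = ƛ rename (liftRen ρ) s
  rename ρ (s ∙ t)   = rename ρ s ∙ rename ρ t
  rename ρ ⟨ s , t ⟩ = ⟨ rename ρ s , rename ρ t ⟩
  rename ρ (π₁ s)    = π₁ (rename ρ s)
  rename ρ (π₂ s)    = π₂ (rename ρ s)
  rename ρ ∗         = ∗
  rename ρ (s ⊞ t)   = rename ρ s ⊞ rename ρ t
  rename ρ (α ⊙ s)   = α ⊙ rename ρ s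
  rename ρ 𝟎         = 𝟎
  rename ρ [ s ]     = [ rename ρ s ]
  rename ρ ❴ s ❵     = ❴ rename ρ s ❵

  liftSub : (Fin m → Term n) → Fin (suc m) → Term (suc n)
  liftSub σ zero    = var zero
  liftSub σ (suc x) = rename suc (σ x)

  subst : (Fin m → Term n) → Term m → Term n
  subst σ (var x)   = σ x
  subst σ (ƛ s)     = ƛ subst (liftSub σ) s
  subst σ (s ∙ t)   = subst σ s ∙ subst σ t
  subst σ ⟨ s , t ⟩ = ⟨ subst σ s , subst σ t ⟩
  subst σ (π₁ s)    = π₁ (subst σ s)
  subst σ (π₂ s)    = π₂ (subst σ s)
  subst σ ∗         = ∗
  subst σ (s ⊞ t)   = subst σ s ⊞ subst σ t
  subst σ (α ⊙ s)   = α ⊙ subst σ s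
  subst σ 𝟎         = 𝟎
  subst σ [ s ]     = [ subst σ s ]
  subst σ ❴ s ❵     = ❴ subst σ s ❵

  single : Term n → Fin (suc n) → Term n
  single v zero    = v
  single v (suc x) = var x

  infix 10 _[0←_]

  _[0←_] : Term (suc n) → Term n → Term n
  s [0← v ] = subst (single v) s

  -- A relation R is call-by-value congruent when CbvCong R is contained in R.
  data CbvCong {a} {n : ℕ} (R : Rel (Term n) a) : Rel (Term n) (c ⊔ a) where
    appˡ  : R s s′ → CbvCong R (s ∙ t) (s′ ∙ t)
    appʳ  : R s s′ → CbvCong R (t ∙ s) (t ∙ s′)
    sumˡ  : R s s′ → CbvCong R (s ⊞ t) (s′ ⊞ t)
    sumʳ  : R s s′ → CbvCong R (t ⊞ s) (t ⊞ s′)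
    pairˡ : R s s′ → CbvCong R ⟨ s , t ⟩ ⟨ s′ , t ⟩
    pairʳ : R s s′ → CbvCong R ⟨ t , s ⟩ ⟨ t , s′ ⟩
    fst   : R s s′ → CbvCong R (π₁ s) (π₁ s′)
    snd   : R s s′ → CbvCong R (π₂ s) (π₂ s′)
    scal  : R s s′ → CbvCong R (α ⊙ s) (α ⊙ s′)
    run   : R s s′ → CbvCong R ❴ s ❵ ❴ s′ ❵

  infix 4 _≃AC_

  -- The constructor scalar identifies terms whose scalars are equal in 𝒜, since
  -- equality in 𝒜 is the setoid equality _≈_; when _≈_ is _≡_ it is subsumed
  -- by reflexivity.
  data _≃AC_ {n : ℕ} : Rel (Term n) (c ⊔ ℓ) where
    ≃-refl  : s ≃AC s
    ≃-sym   : s ≃AC t → t ≃AC s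
    ≃-trans : r ≃AC s → s ≃AC t → r ≃AC t
    cbv     : CbvCong _≃AC_ s t → s ≃AC t
    lam     : s ≃AC s′ → ƛ s ≃AC ƛ s′
    box     : s ≃AC s′ → [ s ] ≃AC [ s′ ]
    comm    : (s t : Term n) → s ⊞ t ≃AC t ⊞ s
    assoc   : (r s t : Term n) → r ⊞ (s ⊞ t) ≃AC (r ⊞ s) ⊞ t
    scalar  : α ≈ β → α ⊙ s ≃AC β ⊙ s

  -- The smallest call-by-value congruent relation containing R and consistent
  -- with ≃AC.
  data Closure {n : ℕ} (R : Rel (Term n) c) : Rel (Term n) (c ⊔ ℓ) where
    rule       : R s t → Closure R s t
    cbv        : CbvCong (Closure R) s t → Closure R s t
    consistent : s ≃AC s′ → Closure R s′ t′ → t′ ≃AC t → Closure R s t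

  data RuleE {n : ℕ} : Rel (Term n) c where
    ⊙-𝟎 : RuleE (α ⊙ 𝟎) 𝟎
    𝟎-⊞ : RuleE (𝟎 ⊞ s) s
    ⊙-⊙ : RuleE (α ⊙ (β ⊙ s)) ((α * β) ⊙ s)
    0-⊙ : RuleE (0# ⊙ s) 𝟎
    1-⊙ : RuleE (1# ⊙ s) s
    ⊙-⊞ : RuleE (α ⊙ (s ⊞ t)) (α ⊙ s ⊞ α ⊙ t)

  data RuleF {n : ℕ} : Rel (Term n) c where
    factor₂ : RuleF (α ⊙ s ⊞ β ⊙ s) ((α + β) ⊙ s)
    factor₁ : RuleF (α ⊙ s ⊞ s) ((α + 1#) ⊙ s)
    factor₀ : RuleF (s ⊞ s) ((1# + 1#) ⊙ s)

  data RuleA {n : ℕ} : Rel (Term n) c where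
    ⊞-∙ : RuleA ((s ⊞ t) ∙ r) (s ∙ r ⊞ t ∙ r)
    ⊙-∙ : RuleA ((α ⊙ s) ∙ r) (α ⊙ (s ∙ r))
    𝟎-∙ : RuleA (𝟎 ∙ r) 𝟎
    ∙-⊞ : RuleA (r ∙ (s ⊞ t)) (r ∙ s ⊞ r ∙ t)
    ∙-⊙ : RuleA (r ∙ (α ⊙ s)) (α ⊙ (r ∙ s))
    ∙-𝟎 : RuleA (r ∙ 𝟎) 𝟎
    ƛ-⊞ : RuleA (ƛ (s ⊞ t)) ((ƛ s) ⊞ (ƛ t))
    ƛ-⊙ : RuleA (ƛ (α ⊙ s)) (α ⊙ (ƛ s))
    ƛ-𝟎 : RuleA (ƛ 𝟎) 𝟎
    ❴⊞❵ : RuleA ❴ s ⊞ t ❵ (❴ s ❵ ⊞ ❴ t ❵)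
    ❴⊙❵ : RuleA ❴ α ⊙ s ❵ (α ⊙ ❴ s ❵)
    ❴𝟎❵ : RuleA ❴ 𝟎 ❵ 𝟎

  data RuleB {n : ℕ} : Rel (Term n) c where
    β-ƛ   : Value v → RuleB ((ƛ s) ∙ v) (s [0← v ])
    β-box : RuleB ❴ [ s ] ❵ s
    β-π₁  : Value u → Value v → RuleB (π₁ ⟨ u , v ⟩) u
    β-π₂  : Value u → Value v → RuleB (π₂ ⟨ u , v ⟩) v

  infix 4 _⟶_

  _⟶_ : Rel (Term n) (c ⊔ ℓ)
  _⟶_ = Closure RuleA ∪ Closure RuleB ∪ Closure RuleE ∪ Closure RuleF

  Normal : Term n → Set (c ⊔ ℓ)
  Normal s = ¬ (∃[ t ] s ⟶ t)

  -- A finite or infinite sequence is a function to Maybe (Term n) that is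
  -- defined on an initial segment of ℕ.
  record RewriteSequence (n : ℕ) : Set (c ⊔ ℓ) where
    field
      at      : ℕ → Maybe (Term n)
      initial : ∀ i → at i ≡ nothing → at (suc i) ≡ nothing
      step    : ∀ i s → at i ≡ just s →
                (∃[ t ] (at (suc i) ≡ just t × s ⟶ t)) ⊎
                (Normal s × at (suc i) ≡ nothing)

  open RewriteSequence public

  HasLength : RewriteSequence n → ℕ → Set c
  HasLength σ l = ∀ i → i < l ⇔ (∃[ s ] at σ i ≡ just s)

  FiniteWithAtMost : ℕ → RewriteSequence n → Set c
  FiniteWithAtMost N σ = ∃[ l ] (l ≤ N × HasLength σ l)

{-# OPTIONS --safe #-}

-- A term of type A is interpreted by a natural number, its cost, together with
-- a value in a join-semilattice ⟦ A ⟧.  Addition of terms adds costs and joins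
-- values; application and {_} are linear in the cost of their result, with
-- coefficients that grow with the costs of the arguments, which pays for the
-- copies made by the distribution rules.  Every reduction step lowers the cost
-- without raising the value, so the cost of a closed term bounds the length of
-- its rewrite sequences.
module Submission where

open import Defs
open import Algebra.Bundles using (Ring)
open import Data.Fin.Base using (Fin; zero; suc)
open import Data.Maybe.Base using (just; nothing)
open import Data.Nat.Base
  using (ℕ; zero; suc; _+_; _*_; _≤_; _<_; _≤′_; ≤′-refl; ≤′-step; _⊔_; z≤n; s≤s;
         s≤s⁻¹)
open import Data.Nat.Properties
  using (≤-refl; ≤-trans; ≤-reflexive; ≤-total; <-≤-trans; ≰⇒>; ≤⇒≤′; m≤m+n; m≤n+m;
         m≤m⊔n; m≤n⊔m; ⊔-lub; n<1+n; n≤1+n; m≤n⇒m<n∨m≡n; +-suc; +-identityʳ; +-mono-≤;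
         +-monoʳ-≤; *-monoˡ-≤; *-monoʳ-≤)
open import Data.Nat.Tactic.RingSolver using (solve-∀)
open import Data.Product.Base using (Σ-syntax; ∃-syntax; _×_; _,_; proj₁; proj₂)
open import Data.Sum.Base using (inj₁; inj₂)
open import Data.Unit.Base using (⊤; tt)
open import Data.Vec.Base using (Vec; []; _∷_; lookup)
open import Data.Vec.Relation.Unary.All using (All; []; _∷_)
open import Data.Vec.Relation.Unary.All.Properties using (lookup⁺)
open import Function.Base using (case_of_)
open import Function.Bundles using (mk⇔)
open import Level using (Level)
open import Relation.Binary.PropositionalEquality.Core
  using (_≡_; refl; sym; trans; subst)

-- Arithmetic of the cost coefficients

≤-by : ∀ {m n} k → n ≡ m + k → m ≤ n
≤-by {m} k eq = ≤-trans (m≤m+n m k) (≤-reflexive (sym eq))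

-- The slope 3 makes `N (1 + 2 * c)` equal to `2 + 2 * N c`, so a coefficient absorbs a scalar with
-- one unit to spare; the constant 1 keeps coefficients positive.
N : ℕ → ℕ
N c = suc (3 * c)

N-+ : ∀ c d {x y m} → x ≤ m → y ≤ m → 0 < m →
      2 + (N c * x + N d * y) < N (2 + (c + d)) * m
N-+ c d {m = suc m} x≤m y≤m _ = ≤-trans
  (+-monoʳ-≤ 3 (+-mono-≤ (*-monoʳ-≤ (N c) x≤m) (*-monoʳ-≤ (N d) y≤m)))
  (≤-by (5 * m + 2) (eq c d m))
  where
  eq : ∀ c d m → suc (3 * (2 + (c + d))) * suc m ≡
       3 + (suc (3 * c) * suc m + suc (3 * d) * suc m) + (5 * m + 2)
  eq = solve-∀

N-* : ∀ c {x m} → x ≤ m → 0 < m → 1 + 2 * (N c * x) < N (1 + 2 * c) * m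
N-* c {m = suc m} x≤m _ = ≤-trans
  (+-monoʳ-≤ 2 (*-monoʳ-≤ 2 (*-monoʳ-≤ (N c) x≤m)))
  (≤-by (2 * m) (eq c m))
  where
  eq : ∀ c m → suc (3 * (1 + 2 * c)) * suc m ≡
       2 + 2 * (suc (3 * c) * suc m) + 2 * m
  eq = solve-∀

-- A drop of `i` inside the coefficient gains at least `i` because the factor `y` is positive; a
-- drop of `j` in the factor gains at least `j` because `N c` is positive.
N-mono : ∀ {i j c d x y} → i + c ≤ d → j + x ≤ y → 0 < y →
         i + j + N c * x ≤ N d * y
N-mono {i} {j} {c} {d} {x} {suc y} c≤d x≤y _ = ≤-trans
  (≤-by (j * (3 * c)) (eq₁ i j c x))
  (≤-trans (+-monoʳ-≤ i (*-monoʳ-≤ (N c) x≤y))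
  (≤-trans (≤-by (2 * i + 3 * i * y) (eq₂ i c y))
           (*-monoˡ-≤ (suc y) (s≤s (*-monoʳ-≤ 3 c≤d)))))
  where
  eq₁ : ∀ i j c x → i + suc (3 * c) * (j + x) ≡
        i + j + suc (3 * c) * x + j * (3 * c)
  eq₁ = solve-∀
  eq₂ : ∀ i c y → suc (3 * (i + c)) * suc y ≡
        i + suc (3 * c) * suc y + (2 * i + 3 * i * y)
  eq₂ = solve-∀

N*-+ : ∀ c {x y z} → 2 + (x + y) < z → 2 + (N c * x + N c * y) < N c * z
N*-+ c {x} {y} p = ≤-trans (≤-by (9 * c) (eq c x y)) (*-monoʳ-≤ (N c) p)
  where
  eq : ∀ c x y → suc (3 * c) * (3 + (x + y)) ≡
       3 + (suc (3 * c) * x + suc (3 * c) * y) + 9 * c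
  eq = solve-∀

N*-* : ∀ c {x y} → 1 + 2 * x < y → 1 + 2 * (N c * x) < N c * y
N*-* c {x} p = ≤-trans (≤-by (6 * c) (eq c x)) (*-monoʳ-≤ (N c) p)
  where
  eq : ∀ c x → suc (3 * c) * (2 + 2 * x) ≡ 2 + 2 * (suc (3 * c) * x) + 6 * c
  eq = solve-∀

≤N* : ∀ c x → x ≤ N c * x
≤N* c x = m≤m+n x _

-- Costed semilattices

record Domain : Set₁ where
  field
    Carrier : Set
    _≼_     : Carrier → Carrier → Set
    ⊥       : Carrier
    _∨_     : Carrier → Carrier → Carrier
    ≼-refl  : ∀ {v} → v ≼ v
    ≼-trans : ∀ {u v w} → u ≼ v → v ≼ w → u ≼ w
    ⊥-min   : ∀ {v} → ⊥ ≼ v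
    ∨-ub₁   : ∀ {v w} → v ≼ (v ∨ w)
    ∨-ub₂   : ∀ {v w} → w ≼ (v ∨ w)
    ∨-lub   : ∀ {u v w} → u ≼ w → v ≼ w → (u ∨ v) ≼ w

open Domain using (Carrier; ⊥)

infixr 4 _,_
record Costed (L : Domain) : Set where
  constructor _,_
  field
    cost : ℕ
    val  : Carrier L

open Costed

private variable
  L K : Domain
  i j : ℕ

infix 4 _≤⟨_⟩_ _⊑_

-- The gap `i` concerns the cost only. It is 1 for a reduction step and 0 for `≃AC` and
-- substitution, so one set of congruence lemmas serves them all.
record _≤⟨_⟩_ (a : Costed L) (i : ℕ) (b : Costed L) : Set where
  constructor _,_
  open Domain L using (_≼_)
  field
    cost≤ : i + cost a ≤ cost b
    val≼  : val a ≼ val b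

open _≤⟨_⟩_

_⊑_ : Costed L → Costed L → Set
a ⊑ b = a ≤⟨ 0 ⟩ b

⊑-refl : {a : Costed L} → a ⊑ a
⊑-refl {L} = ≤-refl , Domain.≼-refl L

≤⟨⟩-trans : {a b c : Costed L} → a ≤⟨ i ⟩ b → b ≤⟨ j ⟩ c → a ≤⟨ j + i ⟩ c
≤⟨⟩-trans {L} {i} {j} {a} (p , p′) (q , q′) =
  ≤-trans (≤-trans (≤-reflexive (eq i j (cost a))) (+-monoʳ-≤ j p)) q ,
  Domain.≼-trans L p′ q′
  where
  eq : ∀ i j x → j + i + x ≡ j + (i + x)
  eq = solve-∀

Costᴰ : Domain → Domain
Costᴰ L = record
  { Carrier = Costed L
  ; _≼_     = _⊑_
  ; ⊥       = 0 , ⊥ L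
  -- A maximum, so that the join is a least upper bound; the coefficients `N` pay for the copies
  -- made by distribution.
  ; _∨_     = λ a b → cost a ⊔ cost b , val a ∨ val b
  ; ≼-refl  = ⊑-refl
  ; ≼-trans = ≤⟨⟩-trans
  ; ⊥-min   = z≤n , ⊥-min
  ; ∨-ub₁   = m≤m⊔n _ _ , ∨-ub₁
  ; ∨-ub₂   = λ {a} → m≤n⊔m (cost a) _ , ∨-ub₂
  ; ∨-lub   = λ p q → ⊔-lub (cost≤ p) (cost≤ q) , ∨-lub (val≼ p) (val≼ q)
  }
  where open Domain L hiding (Carrier; ⊥)

𝟙ᴰ : Domain
𝟙ᴰ = record
  { Carrier = ⊤
  ; _≼_     = λ _ _ → ⊤
  ; ⊥       = tt
  ; _∨_     = λ _ _ → tt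
  ; ≼-refl  = tt
  ; ≼-trans = λ _ _ → tt
  ; ⊥-min   = tt
  ; ∨-ub₁   = tt
  ; ∨-ub₂   = tt
  ; ∨-lub   = λ _ _ → tt
  }

infixr 7 _×ᴰ_ _→ᴰ_

_×ᴰ_ : Domain → Domain → Domain
L ×ᴰ K = record
  { Carrier = Carrier L × Carrier K
  ; _≼_     = λ (u , v) (u′ , v′) → u L.≼ u′ × v K.≼ v′
  ; ⊥       = L.⊥ , K.⊥
  ; _∨_     = λ (u , v) (u′ , v′) → u L.∨ u′ , v K.∨ v′
  ; ≼-refl  = L.≼-refl , K.≼-refl
  ; ≼-trans = λ (p , p′) (q , q′) → L.≼-trans p q , K.≼-trans p′ q′
  ; ⊥-min   = L.⊥-min , K.⊥-min
  ; ∨-ub₁   = L.∨-ub₁ , K.∨-ub₁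
  ; ∨-ub₂   = L.∨-ub₂ , K.∨-ub₂
  ; ∨-lub   = λ (p , p′) (q , q′) → L.∨-lub p q , K.∨-lub p′ q′
  }
  where
  module L = Domain L
  module K = Domain K

-- Arguments come with their cost because a value such as `u ∙ v` can still reduce after β has
-- copied it.
record Monotone (L K : Domain) : Set where
  field
    apply : Costed L → Costed K
    mono  : ∀ {a b} → a ⊑ b → apply a ⊑ apply b

open Monotone

_→ᴰ_ : Domain → Domain → Domain
L →ᴰ K = record
  { Carrier = Monotone L K
  ; _≼_     = λ f g → ∀ a → apply f a ⊑ apply g a
  ; ⊥       = record { apply = λ _ → K.⊥ ; mono = λ _ → ⊑-refl }
  ; _∨_     = λ f g → record
    { apply = λ a → apply f a K.∨ apply g a
    ; mono  = λ p → K.∨-lub (K.≼-trans (mono f p) K.∨-ub₁)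
                            (K.≼-trans (mono g p) K.∨-ub₂)
    }
  ; ≼-refl  = λ _ → ⊑-refl
  ; ≼-trans = λ p q a → K.≼-trans (p a) (q a)
  ; ⊥-min   = λ _ → K.⊥-min
  ; ∨-ub₁   = λ _ → K.∨-ub₁
  ; ∨-ub₂   = λ _ → K.∨-ub₂
  ; ∨-lub   = λ p q a → K.∨-lub (p a) (q a)
  }
  where module K = Domain (Costᴰ K)

-- Costs of the term formers

zeroᶜ : Costed L
zeroᶜ {L} = 0 , ⊥ L

-- The surcharge 2 is one more than that of a scalar, which both `⊙-⊞` and `factor₀` need in order
-- to decrease the cost.
sumᶜ : Costed L → Costed L → Costed L
sumᶜ {L} a b = 2 + (cost a + cost b) , Domain._∨_ L (val a) (val b)

-- The value is not doubled: a factorisation of s + s keeps only one of the two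
-- typing derivations of s, and it must be possible to choose the cheaper one.
scalᶜ : Costed L → Costed L
scalᶜ a = 1 + 2 * cost a , val a

unitᶜ : Costed 𝟙ᴰ
unitᶜ = 0 , tt

-- No reduction takes place inside a box, so the cost of the body waits in the value until `runᶜ`
-- releases it.
boxᶜ : Costed L → Costed (Costᴰ L)
boxᶜ a = 0 , a

runᶜ : Costed (Costᴰ L) → Costed L
runᶜ a = N (cost a) * suc (cost (val a)) , val (val a)

-- Reduction does take place inside a pair, so the component costs are charged at once; they are
-- also stored in the value, where `fstᶜ` and `sndᶜ` read them.
pairᶜ : Costed L → Costed K → Costed (Costᴰ L ×ᴰ Costᴰ K)
pairᶜ a b = cost a + cost b , (a , b)

fstᶜ : Costed (Costᴰ L ×ᴰ Costᴰ K) → Costed L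
fstᶜ p = let a = proj₁ (val p) in suc (cost p + cost a) , val a

sndᶜ : Costed (Costᴰ L ×ᴰ Costᴰ K) → Costed K
sndᶜ p = let b = proj₂ (val p) in suc (cost p + cost b) , val b

-- No reduction takes place under ƛ; the cost at the least argument only has to
-- pay for distributing ƛ over the sums and scalars of its body.
lamᶜ : Monotone L K → Costed (L →ᴰ K)
lamᶜ f = N (cost (apply f zeroᶜ)) , f

-- Sums and scalars are distributed out of either side, so both costs enter as coefficients. The
-- successor keeps the product positive and pays for `β-ƛ`.
appᶜ : Costed (L →ᴰ K) → Costed L → Costed K
appᶜ a b = let r = apply (val a) b in
  N (cost a) * (N (cost b) * suc (cost r)) , val r

-- Monotonicity of the term formers, with gaps

proj-cost : ∀ i {x x′ y y′} → i + x ≤ x′ → y ≤ y′ → i + suc (x + y) ≤ suc (x′ + y′)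
proj-cost i {x} {y = y} p q = ≤-trans (≤-reflexive (eq i x y)) (s≤s (+-mono-≤ p q))
  where
  eq : ∀ i x y → i + suc (x + y) ≡ suc (i + x + y)
  eq = solve-∀

sum-mono : {a a′ b b′ : Costed L} → a ≤⟨ i ⟩ a′ → b ≤⟨ j ⟩ b′ →
           sumᶜ a b ≤⟨ i + j ⟩ sumᶜ a′ b′
sum-mono {L} {i} {j} {a} {b = b} (p , p′) (q , q′) =
  ≤-trans (≤-reflexive (eq i j (cost a) (cost b))) (+-monoʳ-≤ 2 (+-mono-≤ p q)) ,
  ∨-lub (≼-trans p′ ∨-ub₁) (≼-trans q′ ∨-ub₂)
  where
  open Domain L
  eq : ∀ i j x y → i + j + (2 + (x + y)) ≡ 2 + ((i + x) + (j + y))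
  eq = solve-∀

scal-mono : {a b : Costed L} → a ≤⟨ i ⟩ b → scalᶜ a ≤⟨ i ⟩ scalᶜ b
scal-mono {i = i} {a} (p , p′) =
  ≤-trans (≤-by i (eq i (cost a))) (s≤s (*-monoʳ-≤ 2 p)) , p′
  where
  eq : ∀ i x → suc (2 * (i + x)) ≡ i + suc (2 * x) + i
  eq = solve-∀

run-mono : {a b : Costed (Costᴰ L)} → a ≤⟨ i ⟩ b → runᶜ a ≤⟨ i ⟩ runᶜ b
run-mono {i = i} {a} {b} (p , p′) =
  subst (λ k → k + _ ≤ cost (runᶜ b)) (+-identityʳ i)
    (N-mono {i} {0} p (s≤s (cost≤ p′)) (s≤s z≤n)) ,
  val≼ p′

weaken : {a b : Costed L} → a ≤⟨ i ⟩ b → a ⊑ b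
weaken (p , p′) = ≤-trans (m≤n+m _ _) p , p′

pair-mono : {a a′ : Costed L} {b b′ : Costed K} → a ≤⟨ i ⟩ a′ → b ≤⟨ j ⟩ b′ →
            pairᶜ a b ≤⟨ i + j ⟩ pairᶜ a′ b′
pair-mono {i = i} {j} {a} {b = b} p q =
  ≤-trans (≤-reflexive (eq i j (cost a) (cost b))) (+-mono-≤ (cost≤ p) (cost≤ q)) ,
  (weaken p , weaken q)
  where
  eq : ∀ i j x y → i + j + (x + y) ≡ (i + x) + (j + y)
  eq = solve-∀

fst-mono : {a b : Costed (Costᴰ L ×ᴰ Costᴰ K)} → a ≤⟨ i ⟩ b →
           fstᶜ a ≤⟨ i ⟩ fstᶜ b
fst-mono {i = i} (p , (q , _)) = proj-cost i p (cost≤ q) , val≼ q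

snd-mono : {a b : Costed (Costᴰ L ×ᴰ Costᴰ K)} → a ≤⟨ i ⟩ b →
           sndᶜ a ≤⟨ i ⟩ sndᶜ b
snd-mono {i = i} (p , (_ , q)) = proj-cost i p (cost≤ q) , val≼ q

box-mono : {a b : Costed L} → a ⊑ b → boxᶜ a ⊑ boxᶜ b
box-mono p = z≤n , p

lam-mono : {f g : Monotone L K} → (∀ a → apply f a ⊑ apply g a) →
           lamᶜ f ⊑ lamᶜ g
lam-mono p = s≤s (*-monoʳ-≤ 3 (cost≤ (p zeroᶜ))) , p

-- A function may ignore its argument, so `apply` does not transmit the gap `j`. The gap is gained
-- through the coefficient `N (cost b)`, and the results are compared with gap 0.
app-mono : {a a′ : Costed (L →ᴰ K)} {b b′ : Costed L} →
           a ≤⟨ i ⟩ a′ → b ≤⟨ j ⟩ b′ → appᶜ a b ≤⟨ i + j ⟩ appᶜ a′ b′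
app-mono {i = i} {j} {a′ = a′} {b} {b′} (p , p′) q =
  subst (λ k → i + k + _ ≤ cost (appᶜ a′ b′)) (+-identityʳ j)
    (N-mono {i} p (N-mono {j} {0} (cost≤ q) (s≤s (cost≤ r)) (s≤s z≤n)) (s≤s z≤n)) ,
  val≼ r
  where
  r = ≤⟨⟩-trans (p′ b) (mono (val a′) (weaken q))

-- Cost drops along the rewrite rules

zero-< : {a : Costed L} → 0 < cost a → zeroᶜ ≤⟨ 1 ⟩ a
zero-< {L} p = p , Domain.⊥-min L

<-scal : {a : Costed L} → a ≤⟨ 1 ⟩ scalᶜ a
<-scal {L} = s≤s (m≤m+n _ _) , Domain.≼-refl L

<-sumˡ : {a b : Costed L} → a ≤⟨ 1 ⟩ sumᶜ a b
<-sumˡ {L} {a} = s≤s (≤-trans (m≤m+n (cost a) _) (n≤1+n _)) , Domain.∨-ub₁ L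

<-sumʳ : {a b : Costed L} → b ≤⟨ 1 ⟩ sumᶜ a b
<-sumʳ {L} {a} {b} = s≤s (≤-trans (m≤n+m (cost b) (cost a)) (n≤1+n _)) , Domain.∨-ub₂ L

sum-comm : {a b : Costed L} → sumᶜ b a ⊑ sumᶜ a b
sum-comm {L} {a} {b} = ≤-reflexive (eq (cost a) (cost b)) , ∨-lub ∨-ub₂ ∨-ub₁
  where
  open Domain L
  eq : ∀ x y → 2 + (y + x) ≡ 2 + (x + y)
  eq = solve-∀

sum-assocˡ : {a b c : Costed L} → sumᶜ (sumᶜ a b) c ⊑ sumᶜ a (sumᶜ b c)
sum-assocˡ {L} {a} {b} {c} =
  ≤-reflexive (eq (cost a) (cost b) (cost c)) ,
  ∨-lub (∨-lub ∨-ub₁ (≼-trans ∨-ub₁ ∨-ub₂)) (≼-trans ∨-ub₂ ∨-ub₂)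
  where
  open Domain L
  eq : ∀ x y z → 2 + ((2 + (x + y)) + z) ≡ 2 + (x + (2 + (y + z)))
  eq = solve-∀

sum-assocʳ : {a b c : Costed L} → sumᶜ a (sumᶜ b c) ⊑ sumᶜ (sumᶜ a b) c
sum-assocʳ {L} {a} {b} {c} =
  ≤-reflexive (eq (cost a) (cost b) (cost c)) ,
  ∨-lub (≼-trans ∨-ub₁ ∨-ub₁) (∨-lub (≼-trans ∨-ub₂ ∨-ub₁) ∨-ub₂)
  where
  open Domain L
  eq : ∀ x y z → 2 + (x + (2 + (y + z))) ≡ 2 + ((2 + (x + y)) + z)
  eq = solve-∀

-- The surcharge of the sum, doubled by the scalar, covers the outer sum and the second scalar with
-- exactly one unit left.
scal-sum : {a b : Costed L} → sumᶜ (scalᶜ a) (scalᶜ b) ≤⟨ 1 ⟩ scalᶜ (sumᶜ a b)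
scal-sum {L} {a} {b} = ≤-reflexive (eq (cost a) (cost b)) , Domain.≼-refl L
  where
  eq : ∀ x y → 1 + (2 + ((1 + 2 * x) + (1 + 2 * y))) ≡ 1 + 2 * (2 + (x + y))
  eq = solve-∀

sum-factor : {a b : Costed L} → cost a ≤ cost b → scalᶜ a ≤⟨ 1 ⟩ sumᶜ a b
sum-factor {L} {a} {b} p =
  s≤s (s≤s (+-monoʳ-≤ (cost a) (≤-trans (≤-reflexive (+-identityʳ (cost a))) p))) ,
  Domain.∨-ub₁ L

app-sumˡ : {a b : Costed (L →ᴰ K)} {c : Costed L} →
           sumᶜ (appᶜ a c) (appᶜ b c) ≤⟨ 1 ⟩ appᶜ (sumᶜ a b) c
app-sumˡ {K = K} {a = a} {b} {c} =
  N-+ (cost a) (cost b) (*-monoʳ-≤ (N (cost c)) (s≤s (m≤m⊔n _ _)))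
      (*-monoʳ-≤ (N (cost c)) (s≤s (m≤n⊔m (cost (apply (val a) c)) _))) (s≤s z≤n) ,
  Domain.≼-refl K

app-scalˡ : {a : Costed (L →ᴰ K)} {b : Costed L} →
            scalᶜ (appᶜ a b) ≤⟨ 1 ⟩ appᶜ (scalᶜ a) b
app-scalˡ {K = K} {a = a} = N-* (cost a) ≤-refl (s≤s z≤n) , Domain.≼-refl K

-- `apply (val a)` need not be additive; by monotonicity its results at `b` and at `c` both lie
-- below its result at the sum, which suffices for `N-+`.
app-sumʳ : {a : Costed (L →ᴰ K)} {b c : Costed L} →
           sumᶜ (appᶜ a b) (appᶜ a c) ≤⟨ 1 ⟩ appᶜ a (sumᶜ b c)
app-sumʳ {K = K} {a = a} {b} {c} =
  N*-+ (cost a) {N (cost b) * suc (cost (apply (val a) b))}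
       (N-+ (cost b) (cost c) (s≤s (cost≤ p)) (s≤s (cost≤ q)) (s≤s z≤n)) ,
  Domain.∨-lub K (val≼ p) (val≼ q)
  where
  p = mono (val a) (weaken (<-sumˡ {a = b} {c}))
  q = mono (val a) (weaken (<-sumʳ {a = b} {c}))

app-scalʳ : {a : Costed (L →ᴰ K)} {b : Costed L} →
            scalᶜ (appᶜ a b) ≤⟨ 1 ⟩ appᶜ a (scalᶜ b)
app-scalʳ {a = a} {b} =
  N*-* (cost a) {N (cost b) * suc (cost (apply (val a) b))}
       (N-* (cost b) (s≤s (cost≤ p)) (s≤s z≤n)) ,
  val≼ p
  where
  p = mono (val a) (weaken (<-scal {a = b}))

-- The join of functions takes the maximum of the result costs, whereas the sum in the body adds
-- them, so distributing `ƛ` can only lower the value.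
lam-sum : {f g h : Monotone L K} →
          (∀ a → sumᶜ (apply f a) (apply g a) ⊑ apply h a) →
          sumᶜ (lamᶜ f) (lamᶜ g) ≤⟨ 1 ⟩ lamᶜ h
lam-sum {K = K} {f} {g} p =
  ≤-trans (≤-by 2 (eq (cost (apply f zeroᶜ)) (cost (apply g zeroᶜ))))
          (s≤s (*-monoʳ-≤ 3 (cost≤ (p zeroᶜ)))) ,
  λ a → Domain.∨-lub (Costᴰ K) (≤⟨⟩-trans (weaken (<-sumˡ {a = apply f a})) (p a))
                               (≤⟨⟩-trans (weaken (<-sumʳ {a = apply f a})) (p a))
  where
  eq : ∀ x y → suc (3 * (2 + (x + y))) ≡ 3 + (suc (3 * x) + suc (3 * y)) + 2
  eq = solve-∀

lam-scal : {f g : Monotone L K} → (∀ a → scalᶜ (apply f a) ⊑ apply g a) →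
           scalᶜ (lamᶜ f) ≤⟨ 1 ⟩ lamᶜ g
lam-scal {f = f} p =
  ≤-trans (≤-reflexive (eq (cost (apply f zeroᶜ))))
          (s≤s (*-monoʳ-≤ 3 (cost≤ (p zeroᶜ)))) ,
  λ a → ≤⟨⟩-trans (weaken <-scal) (p a)
  where
  eq : ∀ x → 2 + 2 * suc (3 * x) ≡ suc (3 * (1 + 2 * x))
  eq = solve-∀

run-sum : {a b : Costed (Costᴰ L)} →
          sumᶜ (runᶜ a) (runᶜ b) ≤⟨ 1 ⟩ runᶜ (sumᶜ a b)
run-sum {L} {a} {b} =
  N-+ (cost a) (cost b) (s≤s (m≤m⊔n _ _)) (s≤s (m≤n⊔m (cost (val a)) _)) (s≤s z≤n) ,
  Domain.≼-refl L

run-scal : {a : Costed (Costᴰ L)} → scalᶜ (runᶜ a) ≤⟨ 1 ⟩ runᶜ (scalᶜ a)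
run-scal {L} {a} = N-* (cost a) ≤-refl (s≤s z≤n) , Domain.≼-refl L

app-lam : {f : Monotone L K} {a : Costed L} → apply f a ≤⟨ 1 ⟩ appᶜ (lamᶜ f) a
app-lam {K = K} {f} {a} =
  ≤-trans (≤N* (cost a) _) (≤N* (cost (lamᶜ f)) _) , Domain.≼-refl K

run-box : {a : Costed L} → a ≤⟨ 1 ⟩ runᶜ (boxᶜ a)
run-box {L} = m≤m+n _ _ , Domain.≼-refl L

fst-pair : {a : Costed L} {b : Costed K} → a ≤⟨ 1 ⟩ fstᶜ (pairᶜ a b)
fst-pair {L} = s≤s (m≤n+m _ _) , Domain.≼-refl L

snd-pair : {a : Costed L} {b : Costed K} → b ≤⟨ 1 ⟩ sndᶜ (pairᶜ a b)
snd-pair {K = K} = s≤s (m≤n+m _ _) , Domain.≼-refl K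

-- Interpretation of types and typing derivations

module Interpretation {c ℓ k} (𝒜 : Ring c ℓ) (TyConst : Set k) where

  open Calculus 𝒜 TyConst renaming (subst to substTm)

  private variable
    r : Level
    m n : ℕ
    A B : Type
    Δ Δ′ : Vec Type n
    s s′ t t′ : Term n

  ⟦_⟧ᵗ : Type → Domain
  ⟦ ι _ ⟧ᵗ   = 𝟙ᴰ
  ⟦ A ⇒ B ⟧ᵗ = ⟦ A ⟧ᵗ →ᴰ ⟦ B ⟧ᵗ
  ⟦ A ⊗ B ⟧ᵗ = Costᴰ ⟦ A ⟧ᵗ ×ᴰ Costᴰ ⟦ B ⟧ᵗ
  ⟦ unit ⟧ᵗ  = 𝟙ᴰ
  ⟦ M A ⟧ᵗ   = Costᴰ ⟦ A ⟧ᵗ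

  Env : Vec Type n → Set k
  Env = All (λ A → Costed ⟦ A ⟧ᵗ)

  infix 4 _⊑ᴱ_

  _⊑ᴱ_ : Env Δ → Env Δ → Set
  γ ⊑ᴱ δ = ∀ x → lookup⁺ γ x ⊑ lookup⁺ δ x

  ∷-mono : {a b : Costed ⟦ A ⟧ᵗ} {γ δ : Env Δ} → a ⊑ b → γ ⊑ᴱ δ →
           _⊑ᴱ_ {Δ = A ∷ Δ} (a ∷ γ) (b ∷ δ)
  ∷-mono p q zero    = p
  ∷-mono p q (suc x) = q x

  ⟦_⟧ : Δ ⊢ s ∶ A → Env Δ → Costed ⟦ A ⟧ᵗ
  -- Interpreting `lam` requires the body to be monotone, hence the mutual definition.
  ⟦⟧-mono : (d : Δ ⊢ s ∶ A) {γ δ : Env Δ} → γ ⊑ᴱ δ → ⟦ d ⟧ γ ⊑ ⟦ d ⟧ δ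

  curryᵐ : A ∷ Δ ⊢ s ∶ B → Env Δ → Monotone ⟦ A ⟧ᵗ ⟦ B ⟧ᵗ
  curryᵐ {A} d γ = record
    { apply = λ a → ⟦ d ⟧ (a ∷ γ)
    ; mono  = λ p → ⟦⟧-mono d (∷-mono {A} p λ _ → ⊑-refl)
    }

  ⟦ var x ⟧ γ    = lookup⁺ γ x
  ⟦ ∗ ⟧ γ        = unitᶜ
  ⟦ 𝟎 ⟧ γ        = zeroᶜ
  ⟦ lam d ⟧ γ    = lamᶜ (curryᵐ d γ)
  ⟦ app d e ⟧ γ  = appᶜ (⟦ d ⟧ γ) (⟦ e ⟧ γ)
  ⟦ fst d ⟧ γ    = fstᶜ (⟦ d ⟧ γ)
  ⟦ snd d ⟧ γ    = sndᶜ (⟦ d ⟧ γ)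
  ⟦ pair d e ⟧ γ = pairᶜ (⟦ d ⟧ γ) (⟦ e ⟧ γ)
  ⟦ scal d ⟧ γ   = scalᶜ (⟦ d ⟧ γ)
  ⟦ run d ⟧ γ    = runᶜ (⟦ d ⟧ γ)
  ⟦ box d ⟧ γ    = boxᶜ (⟦ d ⟧ γ)
  ⟦ sum d e ⟧ γ  = sumᶜ (⟦ d ⟧ γ) (⟦ e ⟧ γ)

  ⟦⟧-mono (var x)    p = p x
  ⟦⟧-mono ∗          p = ⊑-refl
  ⟦⟧-mono 𝟎          p = ⊑-refl
  ⟦⟧-mono (lam {A = A} d) p = lam-mono λ a → ⟦⟧-mono d (∷-mono {A} ⊑-refl p)
  ⟦⟧-mono (app d e)  p = app-mono (⟦⟧-mono d p) (⟦⟧-mono e p)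
  ⟦⟧-mono (fst d)    p = fst-mono (⟦⟧-mono d p)
  ⟦⟧-mono (snd d)    p = snd-mono (⟦⟧-mono d p)
  ⟦⟧-mono (pair d e) p = pair-mono (⟦⟧-mono d p) (⟦⟧-mono e p)
  ⟦⟧-mono (scal d)   p = scal-mono (⟦⟧-mono d p)
  ⟦⟧-mono (run d)    p = run-mono (⟦⟧-mono d p)
  ⟦⟧-mono (box d)    p = box-mono (⟦⟧-mono d p)
  ⟦⟧-mono (sum d e)  p = sum-mono (⟦⟧-mono d p) (⟦⟧-mono e p)

  -- Typing derivations are not unique, so the bound is stated for every
  -- derivation of s, and the derivation of t may depend on it.
  Sim : {Δ : Vec Type m} {Δ′ : Vec Type n} →
        ℕ → (Env Δ → Env Δ′ → Set r) → Term m → Term n → Set _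
  Sim {Δ = Δ} {Δ′} i R s t =
    ∀ A (d : Δ ⊢ s ∶ A) →
    Σ[ d′ ∈ Δ′ ⊢ t ∶ A ] (∀ γ δ → R γ δ → ⟦ d′ ⟧ δ ≤⟨ i ⟩ ⟦ d ⟧ γ)

  -- `R` is abstract because these congruences are used with `Fits` for substitution and with
  -- equality of environments for reduction.
  module _ {Δ : Vec Type m} {Δ′ : Vec Type n} {R : Env Δ → Env Δ′ → Set r} where

    app-sim : Sim i R s t → Sim j R s′ t′ → Sim (i + j) R (s ∙ s′) (t ∙ t′)
    app-sim p q _ (app d e) =
      let d′ , p = p _ d ; e′ , q = q _ e in
      app d′ e′ , λ γ δ r → app-mono (p γ δ r) (q γ δ r)

    sum-sim : Sim i R s t → Sim j R s′ t′ → Sim (i + j) R (s ⊞ s′) (t ⊞ t′)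
    sum-sim p q _ (sum d e) =
      let d′ , p = p _ d ; e′ , q = q _ e in
      sum d′ e′ , λ γ δ r → sum-mono (p γ δ r) (q γ δ r)

    pair-sim : Sim i R s t → Sim j R s′ t′ → Sim (i + j) R ⟨ s , s′ ⟩ ⟨ t , t′ ⟩
    pair-sim p q _ (pair d e) =
      let d′ , p = p _ d ; e′ , q = q _ e in
      pair d′ e′ , λ γ δ r → pair-mono (p γ δ r) (q γ δ r)

    fst-sim : Sim i R s t → Sim i R (π₁ s) (π₁ t)
    fst-sim p _ (fst d) =
      let d′ , p = p _ d in fst d′ , λ γ δ r → fst-mono (p γ δ r)

    snd-sim : Sim i R s t → Sim i R (π₂ s) (π₂ t)
    snd-sim p _ (snd d) =
      let d′ , p = p _ d in snd d′ , λ γ δ r → snd-mono (p γ δ r)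

    -- The cost ignores the scalar itself, so the two may differ; this absorbs the setoid equality
    -- in `scalar`.
    scal-sim : ∀ {α β} → Sim i R s t → Sim i R (α ⊙ s) (β ⊙ t)
    scal-sim p _ (scal d) =
      let d′ , p = p _ d in scal d′ , λ γ δ r → scal-mono (p γ δ r)

    run-sim : Sim i R s t → Sim i R ❴ s ❵ ❴ t ❵
    run-sim p _ (run d) =
      let d′ , p = p _ d in run d′ , λ γ δ r → run-mono (p γ δ r)

    -- Gap 0 only: a box costs 0 whatever its body, so a drop inside would be lost.
    box-sim : Sim 0 R s t → Sim 0 R [ s ] [ t ]
    box-sim p _ (box d) =
      let d′ , p = p _ d in box d′ , λ γ δ r → box-mono (p γ δ r)

    ∗-sim : Sim 0 R ∗ ∗
    ∗-sim _ ∗ = ∗ , λ _ _ _ → ⊑-refl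

    𝟎-sim : Sim 0 R 𝟎 𝟎
    𝟎-sim _ 𝟎 = 𝟎 , λ _ _ _ → ⊑-refl

    -- The type of the bound variable appears only when the derivation is matched, so `S` and the
    -- premise range over all `A`.
    lam-sim : {S : ∀ A → Env (A ∷ Δ) → Env (A ∷ Δ′) → Set r} →
              (∀ A γ δ → R γ δ → ∀ a → S A (a ∷ γ) (a ∷ δ)) →
              (∀ A → Sim 0 (S A) s t) → Sim 0 R (ƛ s) (ƛ t)
    lam-sim lift p _ (lam {A = A} d) =
      let d′ , p = p A _ d in
      lam d′ , λ γ δ r → lam-mono λ a → p (a ∷ γ) (a ∷ δ) (lift A γ δ r a)

  -- Renaming and substitution

  Fits : (Δ : Vec Type m) {Δ′ : Vec Type n} {σ : Fin m → Term n} →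
         (∀ x → Δ′ ⊢ σ x ∶ lookup Δ x) → Env Δ → Env Δ′ → Set
  Fits Δ τ γ δ = ∀ x → ⟦ τ x ⟧ δ ⊑ lookup⁺ γ x

  -- Matching on `τ x` directly would have to unify two stuck `lookup`s; a variable type `B` avoids
  -- this.
  var-suc : ∀ {x} → Δ ⊢ var x ∶ B → A ∷ Δ ⊢ var (suc x) ∶ B
  var-suc (var x) = var (suc x)

  ⟦var-suc⟧ : ∀ {x} (d : Δ ⊢ var x ∶ B) {a : Costed ⟦ A ⟧ᵗ} {γ} →
              ⟦ var-suc {A = A} d ⟧ (a ∷ γ) ≡ ⟦ d ⟧ γ
  ⟦var-suc⟧ (var x) = refl

  module _ {m n} {Δ′ : Vec Type n} {ρ : Fin m → Fin n} (Δ : Vec Type m)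
           (τ : ∀ x → Δ′ ⊢ var (ρ x) ∶ lookup Δ x) where

    liftRen-⊢ : ∀ A x → A ∷ Δ′ ⊢ var (liftRen ρ x) ∶ lookup (A ∷ Δ) x
    liftRen-⊢ A zero    = var zero
    liftRen-⊢ A (suc x) = var-suc (τ x)

    liftRen-fits : ∀ A γ δ → Fits Δ τ γ δ →
                   ∀ a → Fits (A ∷ Δ) (liftRen-⊢ A) (a ∷ γ) (a ∷ δ)
    liftRen-fits A γ δ r a zero    = ⊑-refl
    liftRen-fits A γ δ r a (suc x) rewrite ⟦var-suc⟧ {A = A} (τ x) {a} {δ} = r x

  rename-sim : ∀ {ρ : Fin m → Fin n} Δ (τ : ∀ x → Δ′ ⊢ var (ρ x) ∶ lookup Δ x) →
               ∀ s → Sim 0 (Fits Δ τ) s (rename ρ s)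
  rename-sim Δ τ (var x)   = λ { _ (var x) → τ x , λ _ _ r → r x }
  rename-sim Δ τ (ƛ s)     =
    lam-sim (liftRen-fits Δ τ) λ A → rename-sim (A ∷ Δ) (liftRen-⊢ Δ τ A) s
  rename-sim Δ τ (s ∙ t)   = app-sim (rename-sim Δ τ s) (rename-sim Δ τ t)
  rename-sim Δ τ ⟨ s , t ⟩ = pair-sim (rename-sim Δ τ s) (rename-sim Δ τ t)
  rename-sim Δ τ (π₁ s)    = fst-sim (rename-sim Δ τ s)
  rename-sim Δ τ (π₂ s)    = snd-sim (rename-sim Δ τ s)
  rename-sim Δ τ ∗         = ∗-sim
  rename-sim Δ τ (s ⊞ t)   = sum-sim (rename-sim Δ τ s) (rename-sim Δ τ t)
  rename-sim Δ τ (α ⊙ s)   = scal-sim (rename-sim Δ τ s)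
  rename-sim Δ τ 𝟎         = 𝟎-sim
  rename-sim Δ τ [ s ]     = box-sim (rename-sim Δ τ s)
  rename-sim Δ τ ❴ s ❵     = run-sim (rename-sim Δ τ s)

  module _ {m n} {Δ′ : Vec Type n} {σ : Fin m → Term n} (Δ : Vec Type m)
           (τ : ∀ x → Δ′ ⊢ σ x ∶ lookup Δ x) where

    weaken-sim : ∀ A x → Sim 0 (Fits Δ′ {A ∷ Δ′} (λ y → var (suc y)))
                               (σ x) (rename suc (σ x))
    weaken-sim A x = rename-sim Δ′ (λ y → var (suc y)) (σ x)

    liftSub-⊢ : ∀ A x → A ∷ Δ′ ⊢ liftSub σ x ∶ lookup (A ∷ Δ) x
    liftSub-⊢ A zero    = var zero
    liftSub-⊢ A (suc x) = proj₁ (weaken-sim A x _ (τ x))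

    liftSub-fits : ∀ A γ δ → Fits Δ τ γ δ →
                   ∀ a → Fits (A ∷ Δ) (liftSub-⊢ A) (a ∷ γ) (a ∷ δ)
    liftSub-fits A γ δ r a zero    = ⊑-refl
    liftSub-fits A γ δ r a (suc x) =
      ≤⟨⟩-trans (proj₂ (weaken-sim A x _ (τ x)) δ (a ∷ δ) λ _ → ⊑-refl) (r x)

  -- `Fits` is an inequality because under a binder the images of `σ` are retyped by `weaken-sim`,
  -- which bounds their interpretations only up to `⊑`.
  subst-sim : ∀ {σ : Fin m → Term n} Δ (τ : ∀ x → Δ′ ⊢ σ x ∶ lookup Δ x) →
              ∀ s → Sim 0 (Fits Δ τ) s (substTm σ s)
  subst-sim Δ τ (var x)   = λ { _ (var x) → τ x , λ _ _ r → r x }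
  subst-sim Δ τ (ƛ s)     =
    lam-sim (liftSub-fits Δ τ) λ A → subst-sim (A ∷ Δ) (liftSub-⊢ Δ τ A) s
  subst-sim Δ τ (s ∙ t)   = app-sim (subst-sim Δ τ s) (subst-sim Δ τ t)
  subst-sim Δ τ ⟨ s , t ⟩ = pair-sim (subst-sim Δ τ s) (subst-sim Δ τ t)
  subst-sim Δ τ (π₁ s)    = fst-sim (subst-sim Δ τ s)
  subst-sim Δ τ (π₂ s)    = snd-sim (subst-sim Δ τ s)
  subst-sim Δ τ ∗         = ∗-sim
  subst-sim Δ τ (s ⊞ t)   = sum-sim (subst-sim Δ τ s) (subst-sim Δ τ t)
  subst-sim Δ τ (α ⊙ s)   = scal-sim (subst-sim Δ τ s)
  subst-sim Δ τ 𝟎         = 𝟎-sim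
  subst-sim Δ τ [ s ]     = box-sim (subst-sim Δ τ s)
  subst-sim Δ τ ❴ s ❵     = run-sim (subst-sim Δ τ s)

  -- Equivalence and reduction as simulations

  infix 4 _⊩_≥⟨_⟩_

  _⊩_≥⟨_⟩_ : Vec Type n → Term n → ℕ → Term n → Set _
  Δ ⊩ s ≥⟨ i ⟩ t = Sim i (_≡_ {A = Env Δ}) s t

  ≥-refl : Δ ⊩ s ≥⟨ 0 ⟩ s
  ≥-refl _ d = d , λ { γ .γ refl → ⊑-refl }

  ≥-trans : {r s t : Term n} {Δ : Vec Type n} →
            Δ ⊩ r ≥⟨ i ⟩ s → Δ ⊩ s ≥⟨ j ⟩ t → Δ ⊩ r ≥⟨ i + j ⟩ t
  ≥-trans p q _ d =
    let d′ , p = p _ d ; d″ , q = q _ d′ in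
    d″ , λ γ δ e → ≤⟨⟩-trans (q δ δ refl) (p γ δ e)

  sum-comm-≥ : Δ ⊩ s ⊞ t ≥⟨ 0 ⟩ t ⊞ s
  sum-comm-≥ _ (sum d e) =
    sum e d , λ { γ .γ refl → sum-comm {a = ⟦ d ⟧ γ} }

  lam-≥ : (∀ A → A ∷ Δ ⊩ s ≥⟨ 0 ⟩ t) → Δ ⊩ ƛ s ≥⟨ 0 ⟩ ƛ t
  lam-≥ = lam-sim λ { _ _ _ refl _ → refl }

  -- `Sim` is directed, so `≃-sym` forces both directions to be proved together.
  ≃AC⇒≥ : s ≃AC t → Δ ⊩ s ≥⟨ 0 ⟩ t
  ≃AC⇒≤ : s ≃AC t → Δ ⊩ t ≥⟨ 0 ⟩ s

  ≃AC⇒≥ ≃-refl          = ≥-refl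
  ≃AC⇒≥ (≃-sym p)       = ≃AC⇒≤ p
  ≃AC⇒≥ (≃-trans p q)   = ≥-trans (≃AC⇒≥ p) (≃AC⇒≥ q)
  ≃AC⇒≥ (cbv (appˡ p))  = app-sim (≃AC⇒≥ p) ≥-refl
  ≃AC⇒≥ (cbv (appʳ p))  = app-sim ≥-refl (≃AC⇒≥ p)
  ≃AC⇒≥ (cbv (sumˡ p))  = sum-sim (≃AC⇒≥ p) ≥-refl
  ≃AC⇒≥ (cbv (sumʳ p))  = sum-sim ≥-refl (≃AC⇒≥ p)
  ≃AC⇒≥ (cbv (pairˡ p)) = pair-sim (≃AC⇒≥ p) ≥-refl
  ≃AC⇒≥ (cbv (pairʳ p)) = pair-sim ≥-refl (≃AC⇒≥ p)
  ≃AC⇒≥ (cbv (fst p))   = fst-sim (≃AC⇒≥ p)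
  ≃AC⇒≥ (cbv (snd p))   = snd-sim (≃AC⇒≥ p)
  ≃AC⇒≥ (cbv (scal p))  = scal-sim (≃AC⇒≥ p)
  ≃AC⇒≥ (cbv (run p))   = run-sim (≃AC⇒≥ p)
  ≃AC⇒≥ (lam p)         = lam-≥ λ _ → ≃AC⇒≥ p
  ≃AC⇒≥ (box p)         = box-sim (≃AC⇒≥ p)
  ≃AC⇒≥ (comm s t)      = sum-comm-≥
  ≃AC⇒≥ (assoc r s t) _ (sum d (sum e f)) =
    sum (sum d e) f ,
    λ { γ .γ refl → sum-assocˡ {a = ⟦ d ⟧ γ} }
  ≃AC⇒≥ (scalar _)      = scal-sim ≥-refl

  ≃AC⇒≤ ≃-refl          = ≥-refl
  ≃AC⇒≤ (≃-sym p)       = ≃AC⇒≥ p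
  ≃AC⇒≤ (≃-trans p q)   = ≥-trans (≃AC⇒≤ q) (≃AC⇒≤ p)
  ≃AC⇒≤ (cbv (appˡ p))  = app-sim (≃AC⇒≤ p) ≥-refl
  ≃AC⇒≤ (cbv (appʳ p))  = app-sim ≥-refl (≃AC⇒≤ p)
  ≃AC⇒≤ (cbv (sumˡ p))  = sum-sim (≃AC⇒≤ p) ≥-refl
  ≃AC⇒≤ (cbv (sumʳ p))  = sum-sim ≥-refl (≃AC⇒≤ p)
  ≃AC⇒≤ (cbv (pairˡ p)) = pair-sim (≃AC⇒≤ p) ≥-refl
  ≃AC⇒≤ (cbv (pairʳ p)) = pair-sim ≥-refl (≃AC⇒≤ p)
  ≃AC⇒≤ (cbv (fst p))   = fst-sim (≃AC⇒≤ p)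
  ≃AC⇒≤ (cbv (snd p))   = snd-sim (≃AC⇒≤ p)
  ≃AC⇒≤ (cbv (scal p))  = scal-sim (≃AC⇒≤ p)
  ≃AC⇒≤ (cbv (run p))   = run-sim (≃AC⇒≤ p)
  ≃AC⇒≤ (lam p)         = lam-≥ λ _ → ≃AC⇒≤ p
  ≃AC⇒≤ (box p)         = box-sim (≃AC⇒≤ p)
  ≃AC⇒≤ (comm s t)      = sum-comm-≥
  ≃AC⇒≤ (assoc r s t) _ (sum (sum d e) f) =
    sum d (sum e f) ,
    λ { γ .γ refl → sum-assocʳ {a = ⟦ d ⟧ γ} }
  ≃AC⇒≤ (scalar _)      = scal-sim ≥-refl

  single-⊢ : Δ ⊢ t ∶ A → ∀ x → Δ ⊢ single t x ∶ lookup (A ∷ Δ) x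
  single-⊢ d zero    = d
  single-⊢ d (suc x) = var x

  single-fits : (d : Δ ⊢ t ∶ A) (γ : Env Δ) → Fits (A ∷ Δ) (single-⊢ d) (⟦ d ⟧ γ ∷ γ) γ
  single-fits d γ zero    = ⊑-refl
  single-fits d γ (suc x) = ⊑-refl

  RuleA⇒> : RuleA s t → Δ ⊩ s ≥⟨ 1 ⟩ t
  RuleA⇒> ⊞-∙ _ (app (sum d e) f) =
    sum (app d f) (app e f) , λ { γ .γ refl → app-sumˡ {a = ⟦ d ⟧ γ} {⟦ e ⟧ γ} }
  RuleA⇒> ⊙-∙ _ (app (scal d) e) =
    scal (app d e) , λ { γ .γ refl → app-scalˡ {a = ⟦ d ⟧ γ} }
  RuleA⇒> 𝟎-∙ _ (app 𝟎 e) = 𝟎 , λ { γ .γ refl → zero-< (s≤s z≤n) }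
  RuleA⇒> ∙-⊞ _ (app d (sum e f)) =
    sum (app d e) (app d f) , λ { γ .γ refl → app-sumʳ {a = ⟦ d ⟧ γ} }
  RuleA⇒> ∙-⊙ _ (app d (scal e)) =
    scal (app d e) , λ { γ .γ refl → app-scalʳ {a = ⟦ d ⟧ γ} }
  RuleA⇒> ∙-𝟎 _ (app d 𝟎) = 𝟎 , λ { γ .γ refl → zero-< (s≤s z≤n) }
  RuleA⇒> ƛ-⊞ _ (lam (sum d e)) =
    sum (lam d) (lam e) , λ { γ .γ refl → lam-sum {f = curryᵐ d γ} {curryᵐ e γ}
                                                          λ _ → ⊑-refl }
  RuleA⇒> ƛ-⊙ _ (lam (scal d)) =
    scal (lam d) , λ { γ .γ refl → lam-scal {f = curryᵐ d γ} λ _ → ⊑-refl }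
  RuleA⇒> ƛ-𝟎 _ (lam 𝟎) = 𝟎 , λ { γ .γ refl → zero-< (s≤s z≤n) }
  RuleA⇒> ❴⊞❵ _ (run (sum d e)) =
    sum (run d) (run e) , λ { γ .γ refl → run-sum {a = ⟦ d ⟧ γ} }
  RuleA⇒> ❴⊙❵ _ (run (scal d)) =
    scal (run d) , λ { γ .γ refl → run-scal {a = ⟦ d ⟧ γ} }
  RuleA⇒> ❴𝟎❵ _ (run 𝟎) = 𝟎 , λ { γ .γ refl → zero-< (s≤s z≤n) }

  RuleB⇒> : RuleB s t → Δ ⊩ s ≥⟨ 1 ⟩ t
  RuleB⇒> {Δ = Δ} (β-ƛ {s = s} _) _ (app {A = A} (lam d) e) =
    -- The body interpreted at `⟦ e ⟧ γ` bounds the reduct; `app-lam` supplies the gap.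
    let d′ , p = subst-sim (A ∷ Δ) (single-⊢ e) s _ d in
    d′ , λ { γ .γ refl → ≤⟨⟩-trans (p (⟦ e ⟧ γ ∷ γ) γ (single-fits e γ))
                                   (app-lam {f = curryᵐ d γ}) }
  RuleB⇒> β-box _ (run (box d)) = d , λ { γ .γ refl → run-box }
  RuleB⇒> (β-π₁ _ _) _ (fst (pair d e)) =
    d , λ { γ .γ refl → fst-pair {b = ⟦ e ⟧ γ} }
  RuleB⇒> (β-π₂ _ _) _ (snd (pair d e)) =
    e , λ { γ .γ refl → snd-pair {a = ⟦ d ⟧ γ} }

  RuleE⇒> : RuleE s t → Δ ⊩ s ≥⟨ 1 ⟩ t
  RuleE⇒> ⊙-𝟎 _ (scal 𝟎)        = 𝟎 , λ { γ .γ refl → <-scal }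
  RuleE⇒> 𝟎-⊞ _ (sum 𝟎 d)       = d , λ { γ .γ refl → <-sumʳ {a = zeroᶜ} }
  RuleE⇒> ⊙-⊙ _ (scal (scal d)) = scal d , λ { γ .γ refl → <-scal }
  RuleE⇒> 0-⊙ _ (scal d)        = 𝟎 , λ { γ .γ refl → zero-< (s≤s z≤n) }
  RuleE⇒> 1-⊙ _ (scal d)        = d , λ { γ .γ refl → <-scal }
  RuleE⇒> ⊙-⊞ _ (scal (sum d e)) =
    sum (scal d) (scal e) , λ { γ .γ refl → scal-sum {a = ⟦ d ⟧ γ} }

  -- Stated for closed terms because the derivation kept by factor₀ depends on
  -- the environment, and [] has only one.
  RuleF⇒> : RuleF s t → [] ⊩ s ≥⟨ 1 ⟩ t
  -- As scalars do not affect the cost, the left summand already costs as much as the reduct.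
  RuleF⇒> factor₂ _ (sum (scal d) e) = scal d , λ { γ .γ refl → <-sumˡ }
  RuleF⇒> factor₁ _ (sum (scal d) e) = scal d , λ { γ .γ refl → <-sumˡ }
  RuleF⇒> factor₀ _ (sum d e) with ≤-total (cost (⟦ d ⟧ [])) (cost (⟦ e ⟧ []))
  ... | inj₁ p = scal d , λ { [] [] refl → sum-factor p }
  ... | inj₂ p = scal e , λ { [] [] refl → ≤⟨⟩-trans (sum-factor p) (sum-comm {a = ⟦ d ⟧ []}) }

  -- Call-by-value congruence never goes under a binder, so the context stays empty as `RuleF⇒>`
  -- requires; nor does it enter a box, where the gap would be lost.
  Closure⇒> : {R : Term 0 → Term 0 → Set c} →
              (∀ {s t} → R s t → [] ⊩ s ≥⟨ 1 ⟩ t) →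
              Closure R s t → [] ⊩ s ≥⟨ 1 ⟩ t
  Closure⇒> rule> (rule p)        = rule> p
  Closure⇒> rule> (cbv (appˡ p))  = app-sim (Closure⇒> rule> p) ≥-refl
  Closure⇒> rule> (cbv (appʳ p))  = app-sim ≥-refl (Closure⇒> rule> p)
  Closure⇒> rule> (cbv (sumˡ p))  = sum-sim (Closure⇒> rule> p) ≥-refl
  Closure⇒> rule> (cbv (sumʳ p))  = sum-sim ≥-refl (Closure⇒> rule> p)
  Closure⇒> rule> (cbv (pairˡ p)) = pair-sim (Closure⇒> rule> p) ≥-refl
  Closure⇒> rule> (cbv (pairʳ p)) = pair-sim ≥-refl (Closure⇒> rule> p)
  Closure⇒> rule> (cbv (fst p))   = fst-sim (Closure⇒> rule> p)
  Closure⇒> rule> (cbv (snd p))   = snd-sim (Closure⇒> rule> p)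
  Closure⇒> rule> (cbv (scal p))  = scal-sim (Closure⇒> rule> p)
  Closure⇒> rule> (cbv (run p))   = run-sim (Closure⇒> rule> p)
  Closure⇒> rule> (consistent p q r) =
    ≥-trans (≃AC⇒≥ p) (≥-trans (Closure⇒> rule> q) (≃AC⇒≥ r))

  ⟶⇒> : {s t : Term 0} → s ⟶ t → [] ⊩ s ≥⟨ 1 ⟩ t
  ⟶⇒> (inj₁ p)               = Closure⇒> RuleA⇒> p
  ⟶⇒> (inj₂ (inj₁ p))        = Closure⇒> RuleB⇒> p
  ⟶⇒> (inj₂ (inj₂ (inj₁ p))) = Closure⇒> RuleE⇒> p
  ⟶⇒> (inj₂ (inj₂ (inj₂ p))) = Closure⇒> RuleF⇒> p

  -- Length of rewrite sequences

  Defined-below : RewriteSequence 0 → ℕ → Set c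
  Defined-below τ i = ∀ j → j < i → ∃[ s ] at τ j ≡ just s

  defined-suc : (τ : RewriteSequence 0) → ∀ {i} →
                Defined-below τ i → at τ i ≡ just s → Defined-below τ (suc i)
  defined-suc τ below eq j j≤i with m≤n⇒m<n∨m≡n (s≤s⁻¹ j≤i)
  ... | inj₁ j<i  = below j j<i
  ... | inj₂ refl = _ , eq

  ends : (τ : RewriteSequence 0) → ∀ {l} → at τ l ≡ nothing →
         Defined-below τ l → HasLength τ l
  ends τ {l} end below j = mk⇔ (below j) λ (_ , eq) → ≰⇒> λ l≤j →
    case trans (sym (after (≤⇒≤′ l≤j))) eq of λ ()
    where
    after : ∀ {j} → l ≤′ j → at τ j ≡ nothing
    after ≤′-refl     = end
    after (≤′-step p) = initial τ _ (after p)

  -- `b` is fuel exceeding the cost of the current element. Each step spends one unit and advances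
  -- `i`, so `b + i` is invariant, and the strict bound rules out `b` being zero.
  finite-from : (τ : RewriteSequence 0) (b i : ℕ) →
                Defined-below τ i →
                at τ i ≡ just s → (d : [] ⊢ s ∶ A) → cost (⟦ d ⟧ []) < b →
                FiniteWithAtMost (b + i) τ
  finite-from {s} τ (suc b) i below eq d c<b with step τ i s eq
  ... | inj₂ (_ , end) = suc i , s≤s (m≤n+m i b) , ends τ end (defined-suc τ below eq)
  ... | inj₁ (t , eq′ , s⟶t) =
    let d′ , p = ⟶⇒> s⟶t _ d in
    subst (λ N → FiniteWithAtMost N τ) (+-suc b i)
      (finite-from τ b (suc i) (defined-suc τ below eq) eq′ d′
        (<-≤-trans (cost≤ (p [] [] refl)) (s≤s⁻¹ c<b)))

theorem2p10 : ∀ {c ℓ k} (𝒜 : Ring c ℓ) (TyConst : Set k) →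
    let open Calculus 𝒜 TyConst in
    (s : Term 0) (A : Type) → [] ⊢ s ∶ A →
    ∃[ nₛ ] ((σ : RewriteSequence 0) → at σ 0 ≡ just s → FiniteWithAtMost nₛ σ)
theorem2p10 𝒜 TyConst s A d =
  -- The cost bounds the number of steps, and there is one more element than steps; 0 is the
  -- starting index.
  suc (cost (⟦ d ⟧ [])) + 0 ,
  λ σ eq → finite-from σ _ 0 (λ _ ()) eq d (n<1+n _)
  where open Interpretation 𝒜 TyConst
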